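{- Let $\kappa$ be an uncountable cardinal with $\kappa=\kappa^{<\kappa}$. Assume that every $\mathbf{\Sigma}^1_1$ subset of ${}^\kappa\kappa$ satisfies the Hurewicz dichotomy. (1) If $\kappa$ is not weakly compact, then all $\mathbf{\Sigma}^1_1$ and all $\mathbf{\Pi}^1_1$ subsets of ${}^\kappa\kappa$ are $\kappa$-Sacks measurable. (2) If $\kappa$ is weakly compact, then all $\mathbf{\Sigma}^1_1$ and all $\mathbf{\Pi}^1_1$ subsets of ${}^\kappa\kappa$ are $\kappa$-Miller measurable.
   Context: ${}^\kappa\kappa$ is the set of all functions from $\kappa$ to $\kappa$ with the bounded topology, whose basic open sets are $N_s=\{x\in{}^\kappa\kappa \mid s\subseteq x\}$ for $s\in{}^{<\kappa}\kappa$ (functions from an ordinal ${<}\kappa$ into $\kappa$). A subset of ${}^\kappa\kappa$ is $\mathbf{\Sigma}^1_1$ if it is the projection to the first coordinate of a closed subset of ${}^\kappa\kappa\times{}^\kappa\kappa$ (product topology), and $\mathbf{\Pi}^1_1$ if its complement is $\mathbf{\Sigma}^1_1$. $A\subseteq{}^\kappa\kappa$ is $\kappa$-compact if every open cover of $A$ has a subcover of size less than $\kappa$, and $\mathrm{K}_\kappa$ if it is a union of $\kappa$-many $\kappa$-compact subsets of ${}^\kappa\kappa$. $A\subseteq{}^\kappa\kappa$ satisfies the Hurewicz dichotomy if either $A$ is contained in a $\mathrm{K}_\kappa$ subset of ${}^\kappa\kappa$, or else $A$ contains a closed subset of ${}^\kappa\kappa$ homeomorphic to ${}^\kappa\kappa$.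 A subtree of ${}^{<\kappa}\kappa$ is a subset closed under initial segments; $[T]=\{x\in{}^\kappa\kappa\mid \forall\alpha<\kappa\ (x\restriction\alpha\in T)\}$. A subtree $T$ is superclosed if it is closed under unions of increasing sequences of length ${<}\kappa$. A (nonempty) superclosed subtree $T$ is perfect (respectively, a $\kappa$-Miller tree) if every $t\in T$ is extended by some $s\in T$ which has at least $2$ (respectively, at least $\kappa$-many) immediate successors in $T$. A set $A\subseteq{}^\kappa\kappa$ is $\kappa$-Sacks measurable (respectively, $\kappa$-Miller measurable) if for every perfect (respectively, $\kappa$-Miller) subtree $T\subseteq{}^{<\kappa}\kappa$ there is a perfect (respectively, $\kappa$-Miller) subtree $S\subseteq T$ such that either $[S]\subseteq A$ or $[S]\cap A=\emptyset$. -}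

module Defs where

open import Level using (Level; _⊔_; suc)
open import Data.Bool.Base using (Bool)
open import Data.Fin.Base using (Fin)
open import Data.Irrelevant using ([_])
open import Data.Nat.Base using (ℕ)
open import Data.Product.Base using (Σ-syntax; ∃-syntax; _×_; _,_)
open import Data.Refinement using (Refinement-syntax; value; _,_)
open import Data.Sum.Base using (_⊎_)
open import Function.Base using (_∘_)
open import Function.Bundles using (_↔_; _↣_; Inverse)
open import Induction.WellFounded using (WellFounded)
open import Relation.Binary.Core using (Rel)
open import Relation.Binary.PropositionalEquality.Core using (_≡_)
open import Relation.Binary.Structures using (IsStrictTotalOrder)
open import Relation.Nullary.Negation using (¬_)
open import Relation.Unary using (Pred; _∈_; _⊆_; _≐_; _⊥_; _⊢_; ∁; ⋃; Satisfiable)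

-- The definitions below have their set-theoretic meaning in the presence of
-- excluded middle and function extensionality, under which ∃ (a Σ-type) is
-- classical existence with choice, _≡_ on functions is extensional, and
-- subsets are predicates up to _≐_.

-- Topological spaces are presented by a base; I indexes the basic open sets.
record Space (ℓ : Level) : Set (suc ℓ) where
  field
    Point : Set ℓ
    I     : Set ℓ
    N     : I → Pred Point ℓ

open Space

module _ {ℓ : Level} where

  Open : (X : Space ℓ) → Pred (Pred (Point X) ℓ) ℓ
  Open X U = ∀ {x} → x ∈ U → ∃[ i ] x ∈ N X i × N X i ⊆ U

  Closed : (X : Space ℓ) → Pred (Pred (Point X) ℓ) ℓ
  Closed X C = Open X (∁ C)

  infixr 5 _×ₛ_

  _×ₛ_ : Space ℓ → Space ℓ → Space ℓ
  X ×ₛ Y = record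
    { Point = Point X × Point Y
    ; I     = I X × I Y
    ; N     = λ (i , j) (x , y) → x ∈ N X i × y ∈ N Y j
    }

  Subspace : (X : Space ℓ) → Pred (Point X) ℓ → Space ℓ
  Subspace X A = record
    { Point = [ x ∈ Point X ∣ A x ]
    ; I     = I X
    ; N     = λ i → value ⊢ N X i
    }

  Continuous : (X Y : Space ℓ) → (Point X → Point Y) → Set (suc ℓ)
  Continuous X Y f = ∀ U → Open Y U → Open X (f ⊢ U)

  Homeomorphic : Space ℓ → Space ℓ → Set (suc ℓ)
  Homeomorphic X Y = Σ[ f ∈ Point X ↔ Point Y ]
    Continuous X Y (Inverse.to f) × Continuous Y X (Inverse.from f)

-- A cardinal is an initial ordinal: a well-order that does not inject into
-- any of its proper initial segments.
record Cardinal (ℓ : Level) : Set (suc ℓ) where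
  infix 4 _<_
  field
    Carrier            : Set ℓ
    _<_                : Rel Carrier ℓ
    isStrictTotalOrder : IsStrictTotalOrder _≡_ _<_
    wellFounded        : WellFounded _<_

  -- The ordinal α itself, that is, the set of its predecessors.
  Below : Carrier → Set ℓ
  Below α = [ β ∈ Carrier ∣ β < α ]

  field
    initial : ∀ α → ¬ (Carrier ↣ Below α)

module _ {ℓ : Level} (κ : Cardinal ℓ) where

  open Cardinal κ renaming (Carrier to K)

  Uncountable : Set ℓ
  Uncountable = ¬ (K ↣ ℕ)

  Size<κ : Set ℓ → Set ℓ
  Size<κ X = ∃[ α ] (X ↣ Below α)

  -- Elements of ^{<κ}κ.  An infinite κ is a limit ordinal, so that the
  -- ordinals below κ are exactly the elements of K.
  record Seq : Set ℓ where
    constructor mkSeq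
    field
      length : K
      at     : Below length → K

  open Seq

  -- For infinite κ, the cardinal κ^{<κ} is the size of ^{<κ}κ.
  κ^<κ≡κ : Set ℓ
  κ^<κ≡κ = Seq ↔ K

  -- κ → (κ)²₂; a colouring of [κ]² is read off from its values at α < β.
  WeaklyCompact : Set (suc ℓ)
  WeaklyCompact = Uncountable ×
    (∀ (c : K → K → Bool) →
      Σ[ H ∈ Pred K ℓ ] ([ α ∈ K ∣ H α ] ↔ K) ×
        (∃[ b ] ∀ {α β} → α ∈ H → β ∈ H → α < β → c α β ≡ b))

  Baire : Set ℓ
  Baire = K → K

  -- Inclusion of s in t as sets of pairs: t extends s.
  infix 4 _⊑_
  _⊑_ : Rel Seq ℓ
  s ⊑ t = ∀ (β : Below (length s)) →
    Σ[ β<t ∈ value β < length t ] at t (value β , [ β<t ]) ≡ at s β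

  _↾_ : Baire → K → Seq
  x ↾ α = mkSeq α (x ∘ value)

  BaireSpace : Space ℓ
  BaireSpace = record
    { Point = Baire
    ; I     = Seq
    ; N     = λ s x → ∀ β → x (value β) ≡ at s β
    }

  Σ¹₁ : Pred (Pred Baire ℓ) (suc ℓ)
  Σ¹₁ A = Σ[ C ∈ Pred (Baire × Baire) ℓ ]
    Closed (BaireSpace ×ₛ BaireSpace) C × A ≐ (λ x → ∃[ y ] C (x , y))

  Π¹₁ : Pred (Pred Baire ℓ) (suc ℓ)
  Π¹₁ A = Σ¹₁ (∁ A)

  κ-Compact : Pred (Pred Baire ℓ) (suc ℓ)
  κ-Compact A = ∀ (J : Set ℓ) (U : J → Pred Baire ℓ) →
    (∀ j → Open BaireSpace (U j)) → A ⊆ ⋃ J U →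
    Σ[ J′ ∈ Pred J ℓ ] Size<κ [ j ∈ J ∣ J′ j ] ×
      A ⊆ ⋃ [ j ∈ J ∣ J′ j ] (U ∘ value)

  K-κ : Pred (Pred Baire ℓ) (suc ℓ)
  K-κ A = Σ[ F ∈ (K → Pred Baire ℓ) ] (∀ α → κ-Compact (F α)) × A ≐ ⋃ K F

  HurewiczDichotomy : Pred (Pred Baire ℓ) (suc ℓ)
  HurewiczDichotomy A =
      (Σ[ B ∈ Pred Baire ℓ ] K-κ B × A ⊆ B)
    ⊎ (Σ[ C ∈ Pred Baire ℓ ] C ⊆ A × Closed BaireSpace C ×
        Homeomorphic (Subspace BaireSpace C) BaireSpace)

  Subtree : Pred (Pred Seq ℓ) ℓ
  Subtree T = ∀ {s t} → s ⊑ t → t ∈ T → s ∈ T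

  Branches : Pred Seq ℓ → Pred Baire ℓ
  Branches T x = ∀ α → x ↾ α ∈ T

  -- u is the union of the family s.
  IsUnion : ∀ {α} → (Below α → Seq) → Seq → Set ℓ
  IsUnion s u = (∀ i → s i ⊑ u) × (∀ β → β < length u → ∃[ i ] β < length (s i))

  Superclosed : Pred (Pred Seq ℓ) ℓ
  Superclosed T = ∀ {α} (s : Below α → Seq) →
    (∀ i → s i ∈ T) → (∀ i j → value i < value j → s i ⊑ s j) →
    ∀ u → IsUnion s u → u ∈ T

  -- β is the ordinal successor of α.
  infix 4 _⋖_
  _⋖_ : Rel K ℓ
  α ⋖ β = α < β × (∀ γ → α < γ → ¬ (γ < β))

  ImmediateSuccessors : Pred Seq ℓ → Seq → Set ℓ
  ImmediateSuccessors T s = [ u ∈ Seq ∣ (u ∈ T × s ⊑ u × length s ⋖ length u) ]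

  -- Every node of T is extended by one with at least |X| immediate successors.
  Splitting : ∀ {x} → Set x → Pred (Pred Seq ℓ) (x ⊔ ℓ)
  Splitting X T = ∀ {t} → t ∈ T → ∃[ s ] s ∈ T × t ⊑ s × (X ↣ ImmediateSuccessors T s)

  Perfect : Pred (Pred Seq ℓ) ℓ
  Perfect T = Satisfiable T × Subtree T × Superclosed T × Splitting (Fin 2) T

  Miller : Pred (Pred Seq ℓ) ℓ
  Miller T = Satisfiable T × Subtree T × Superclosed T × Splitting K T

  Measurable : Pred (Pred Seq ℓ) ℓ → Pred (Pred Baire ℓ) (suc ℓ)
  Measurable P A = ∀ T → P T →
    Σ[ S ∈ Pred Seq ℓ ] P S × S ⊆ T × (Branches S ⊆ A ⊎ Branches S ⊥ A)

  SacksMeasurable : Pred (Pred Baire ℓ) (suc ℓ)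
  SacksMeasurable = Measurable Perfect

  MillerMeasurable : Pred (Pred Baire ℓ) (suc ℓ)
  MillerMeasurable = Measurable Miller

{-# OPTIONS --safe #-}

-- A perfect (κ-Miller) tree T contains the image of a "scheme" G : ^κ X → [T]
-- with X = 2 (X = κ): splitting levels along each branch make G injective, and
-- the initial segments of its range form a superclosed X-splitting tree with no
-- new branches.  So it suffices to find a scheme whose range lies in A or misses A.
-- Composing G with an embedding of ^κ κ into ^κ 2 in the perfect case, let
-- F : ^κ κ → [T] and apply the Hurewicz dichotomy to F⁻¹(A).
--
-- If F⁻¹(A) is contained in a K_κ set, there is g : κ → κ such that no x ≥ g is in
-- F⁻¹(A), and { x | x ≥ g } contains the range of a scheme.  Otherwise let h be a
-- homeomorphism of ^κ κ onto a closed subset of F⁻¹(A).  In the perfect case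
-- injectivity of F ∘ h gives splitting nodes, and fusion gives a scheme F ∘ h ∘ H.
-- In the Miller case, h has κ-splitting nodes by κ → (κ)²₂, and fusion makes
-- h ∘ H a scheme, hence also F ∘ h ∘ H.

module Submission where

open import Defs
open import Axiom.ExcludedMiddle using (ExcludedMiddle)
open import Axiom.Extensionality.Propositional using (Extensionality)
open import Data.Bool.Base using (Bool; true; false)
open import Data.Empty using (⊥-elim)
open import Data.Fin.Base using (Fin; zero; suc)
open import Data.Irrelevant using ([_])
open import Data.Product.Base using (Σ-syntax; ∃; ∃-syntax; _×_; _,_; proj₁; proj₂)
open import Data.Refinement using (Refinement-syntax; value; value-injective; _,_)
open import Data.Sum.Base as Sum using (_⊎_; inj₁; inj₂)
open import Data.Unit.Polymorphic.Base using (⊤)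
open import Function.Base using (_∘_; id)
open import Function.Bundles using (_↔_; _↣_; mk↣; Inverse; Injection)
open import Induction.WellFounded using (module All; module FixPoint)
open import Level using (Level; _⊔_) renaming (suc to lsuc)
open import Relation.Binary.Definitions using (tri<; tri≈; tri>)
open import Relation.Binary.PropositionalEquality
  using (_≡_; _≢_; refl; sym; trans; cong; cong₂; subst; subst₂; module ≡-Reasoning)
open import Relation.Binary.Structures using (IsStrictTotalOrder)
open import Relation.Nullary.Decidable.Core using (Dec; does; yes; no; recompute; decidable-stable)
open import Relation.Nullary.Reflects using (Reflects; invert)
open import Relation.Nullary.Negation using (¬_)
open import Relation.Unary using (Pred; _∈_; _⊆_; _⊥_; _⊢_; ∁; Satisfiable)

module _ (em : ∀ {a} → ExcludedMiddle a) (ext : ∀ {a b} → Extensionality a b)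
         {ℓ : Level} (κ : Cardinal ℓ) where

  open Cardinal κ renaming (Carrier to K)
  open IsStrictTotalOrder isStrictTotalOrder using (compare; _<?_)
    renaming (trans to <-trans; irrefl to <-irrefl)
  open Seq

  -- Classical logic and the order of `K`.

  byContradiction : ∀ {p} {P : Set p} → ¬ ¬ P → P
  byContradiction = decidable-stable em

  ¬∀⇒∃¬ : ∀ {a p} {A : Set a} {P : A → Set p} → ¬ (∀ x → P x) → ∃[ x ] ¬ P x
  ¬∀⇒∃¬ ¬∀ = byContradiction λ ¬∃ → ¬∀ λ x → byContradiction λ ¬Px → ¬∃ (x , ¬Px)

  infix 4 _≤_
  _≤_ : K → K → Set ℓ
  α ≤ β = ∀ {γ} → γ < α → γ < β

  <⇒≤ : ∀ {α β} → α < β → α ≤ β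
  <⇒≤ α<β γ<α = <-trans γ<α α<β

  ≤⇒≯ : ∀ {α β} → α ≤ β → ¬ β < α
  ≤⇒≯ α≤β β<α = <-irrefl refl (α≤β β<α)

  ≮⇒≥ : ∀ {α β} → ¬ β < α → α ≤ β
  ≮⇒≥ {α} {β} β≮α {γ} γ<α with compare γ β
  ... | tri< γ<β _ _ = γ<β
  ... | tri≈ _ refl _ = ⊥-elim (β≮α γ<α)
  ... | tri> _ _ β<γ = ⊥-elim (β≮α (<-trans β<γ γ<α))

  ≤-<-trans : ∀ {α β γ} → α ≤ β → β < γ → α < γ
  ≤-<-trans {α} {β} {γ} α≤β β<γ with compare α γ
  ... | tri< α<γ _ _ = α<γ
  ... | tri≈ _ refl _ = ⊥-elim (<-irrefl refl (α≤β β<γ))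
  ... | tri> _ _ γ<α = ⊥-elim (≤⇒≯ α≤β (<-trans β<γ γ<α))

  ≤-total : ∀ α β → α ≤ β ⊎ β ≤ α
  ≤-total α β with compare α β
  ... | tri< α<β _ _ = inj₁ (<⇒≤ α<β)
  ... | tri≈ _ refl _ = inj₁ id
  ... | tri> _ _ β<α = inj₂ (<⇒≤ β<α)

  ≤-antisym : ∀ {α β} → α ≤ β → β ≤ α → α ≡ β
  ≤-antisym {α} {β} α≤β β≤α with compare α β
  ... | tri< α<β _ _ = ⊥-elim (≤⇒≯ β≤α α<β)
  ... | tri≈ _ α≡β _ = α≡β
  ... | tri> _ _ β<α = ⊥-elim (≤⇒≯ α≤β β<α)

  <-induction : ∀ {p} (P : Pred K p) → (∀ α → (∀ {β} → β < α → P β) → P α) → ∀ α → P α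
  <-induction {p} P step = All.wfRec wellFounded p P λ α IH → step α IH

  opaque
    least : ∀ {p} {P : Pred K p} → Satisfiable P →
            ∃[ α ] P α × (∀ {β} → β < α → ¬ P β)
    least {P = P} (α , Pα) = byContradiction λ ¬least →
      <-induction (∁ P) (λ β IH Pβ → ¬least (β , Pβ , IH)) α Pα

  below< : ∀ {α} (i : Below α) → value i < α
  below< {α} (β , [ β<α ]) = recompute (β <? α) β<α

  opaque
    <-recursion : ∀ {a} {A : Set a} (step : ∀ i → (Below i → A) → A) →
                  Σ[ f ∈ (K → A) ] (∀ i → f i ≡ step i (f ∘ value))
    <-recursion {a} {A} step = All.wfRec wellFounded a _ step′ , λ i → unfold-wfRec
      where
      step′ : ∀ i → (∀ {j} → j < i → A) → A
      step′ i IH = step i λ j → IH (below< j)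
      open FixPoint wellFounded (λ _ → A) step′
        (λ i IH≡ → cong (step i) (ext λ j → IH≡ (below< j)))

  -- Agreement below an ordinal, first differences and updates.

  infix 4 _≈[_]_
  _≈[_]_ : ∀ {a} {A : Set a} → (K → A) → K → (K → A) → Set (ℓ ⊔ a)
  x ≈[ α ] y = ∀ {β} → β < α → x β ≡ y β

  module _ {a} {A : Set a} where

    ≈-sym : ∀ {α} {x y : K → A} → x ≈[ α ] y → y ≈[ α ] x
    ≈-sym x≈y β<α = sym (x≈y β<α)

    ≈-trans : ∀ {α} {x y z : K → A} → x ≈[ α ] y → y ≈[ α ] z → x ≈[ α ] z
    ≈-trans x≈y y≈z β<α = trans (x≈y β<α) (y≈z β<α)

    ≈-mono : ∀ {α β} {x y : K → A} → α ≤ β → x ≈[ β ] y → x ≈[ α ] y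
    ≈-mono α≤β x≈y γ<α = x≈y (α≤β γ<α)

    firstDifference : ∀ {x y : K → A} → x ≢ y → ∃[ α ] x ≈[ α ] y × x α ≢ y α
    firstDifference x≢y with least (¬∀⇒∃¬ (x≢y ∘ ext))
    ... | α , xα≢yα , min = α , (λ β<α → byContradiction (min β<α)) , xα≢yα

    infixl 6 _[_≔_]
    _[_≔_] : (K → A) → K → A → K → A
    (x [ α ≔ a ]) β with compare β α
    ... | tri< _ _ _ = x β
    ... | tri≈ _ _ _ = a
    ... | tri> _ _ _ = x β

    updated : ∀ x α {a : A} → (x [ α ≔ a ]) α ≡ a
    updated x α with compare α α
    ... | tri< α<α _ _ = ⊥-elim (<-irrefl refl α<α)
    ... | tri≈ _ _ _ = refl
    ... | tri> _ _ α<α = ⊥-elim (<-irrefl refl α<α)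

    update-≈ : ∀ x α {a : A} → (x [ α ≔ a ]) ≈[ α ] x
    update-≈ x α {β = β} β<α with compare β α
    ... | tri< _ _ _ = refl
    ... | tri≈ _ refl _ = ⊥-elim (<-irrefl refl β<α)
    ... | tri> _ _ _ = refl

  -- Sequences as restrictions of total functions.

  infixl 7 _↿_
  _↿_ : Baire κ → K → Seq κ
  _↿_ = _↾_ κ

  infix 4 _⊑′_
  _⊑′_ : Seq κ → Seq κ → Set ℓ
  _⊑′_ = _⊑_ κ

  -- Beyond the length of s the values of pad s are junk.
  pad : Seq κ → Baire κ
  pad s β with β <? length s
  ... | yes β<s = at s (β , [ β<s ])
  ... | no _ = β

  pad-at : ∀ s (i : Below (length s)) → pad s (value i) ≡ at s i
  pad-at s (β , [ β<s ]) with β <? length s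
  ... | yes _ = refl
  ... | no β≮s = ⊥-elim (β≮s (recompute (β <? length s) β<s))

  pad-↾ : ∀ s → pad s ↿ length s ≡ s
  pad-↾ s = cong (mkSeq (length s)) (ext (pad-at s))

  ↾-pad : ∀ x α → pad (x ↿ α) ≈[ α ] x
  ↾-pad x α β<α = pad-at (x ↿ α) (_ , [ β<α ])

  ↾-cong : ∀ {x y α} → x ≈[ α ] y → x ↿ α ≡ y ↿ α
  ↾-cong {α = α} x≈y = cong (mkSeq α) (ext λ i → x≈y (below< i))

  ↾-injective : ∀ {x y α} → x ↿ α ≡ y ↿ α → x ≈[ α ] y
  ↾-injective {x} {y} {α} eq {β} β<α = trans (sym (↾-pad x α β<α))
    (trans (cong (λ s → pad s β) eq) (↾-pad y α β<α))

  ↾-⊑ : ∀ {x y α β} → α ≤ β → x ≈[ α ] y → x ↿ α ⊑′ y ↿ β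
  ↾-⊑ α≤β x≈y i = α≤β (below< i) , sym (x≈y (below< i))

  ⊑⇒≤ : ∀ s t → s ⊑′ t → length s ≤ length t
  ⊑⇒≤ s t s⊑t β<s = proj₁ (s⊑t (_ , [ β<s ]))

  ⊑⇒≈ : ∀ s t → s ⊑′ t → pad t ≈[ length s ] pad s
  ⊑⇒≈ s t s⊑t {β} β<s with s⊑t (β , [ β<s ])
  ... | β<t , eq = trans (pad-at t (β , [ β<t ])) (trans eq (sym (pad-at s (β , [ β<s ]))))

  ≈⇒⊑ : ∀ s t → length s ≤ length t → pad s ≈[ length s ] pad t → s ⊑′ t
  ≈⇒⊑ s t s≤t s≈t = subst₂ (λ s t → s ⊑′ t) (pad-↾ s) (pad-↾ t) (↾-⊑ s≤t s≈t)

  -- Schemes and their composition.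

  -- G embeds ^κ X so that u ↾ i fixes G u below level u i, while the value of
  -- G u at level u i encodes u i.
  record Scheme {x} (X : Set x) (G : (K → X) → Baire κ) : Set (ℓ ⊔ x) where
    field
      level      : (K → X) → K → K
      level-cong : ∀ {u v i} → u ≈[ i ] v → level u i ≡ level v i
      i≤level    : ∀ u i → i ≤ level u i
      agree      : ∀ {u v i} → u ≈[ i ] v → G u ≈[ level u i ] G v
      separate   : ∀ {u v i} → u ≈[ i ] v → G u (level u i) ≡ G v (level u i) → u i ≡ v i

    injective : ∀ {u v} → G u ≡ G v → u ≡ v
    injective {u} {v} Gu≡Gv = byContradiction λ u≢v →
      let i , u≈v , ui≢vi = firstDifference u≢v
      in ui≢vi (separate u≈v (cong (λ y → y (level u i)) Gu≡Gv))

  -- `ℍ` codes `u i` in the value of `H u` at `ℍ.level u i`, and `𝔾` codes that value in turn at its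
  -- own level for this index.
  Scheme-∘ : ∀ {x} {X : Set x} {G H} → Scheme K G → Scheme X H → Scheme X (G ∘ H)
  Scheme-∘ {H = H} 𝔾 ℍ = record
    { level      = λ u i → 𝔾.level (H u) (ℍ.level u i)
    ; level-cong = λ {u} {v} u≈v → trans (𝔾.level-cong (ℍ.agree u≈v))
                     (cong (𝔾.level (H v)) (ℍ.level-cong u≈v))
    ; i≤level    = λ u i → 𝔾.i≤level (H u) (ℍ.level u i) ∘ ℍ.i≤level u i
    ; agree      = 𝔾.agree ∘ ℍ.agree
    ; separate   = λ u≈v → ℍ.separate u≈v ∘ 𝔾.separate (ℍ.agree u≈v)
    }
    where
    module 𝔾 = Scheme 𝔾
    module ℍ = Scheme ℍ


  -- The tree of initial segments of the range of a scheme.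

  module SchemeTree (noMax : ∀ α → ∃[ β ] α < β)
                    {x} {X : Set x} {G : (K → X) → Baire κ} (scheme : Scheme X G)
                    (u₀ : K → X) where
    open Scheme scheme

    -- By `separate`, at most one `a` qualifies for given `x`, `i` and `IH`, so the choice in
    -- `traceStep` is forced.
    TraceStep : Baire κ → ∀ i → (Below i → X) → X → Set (ℓ ⊔ x)
    TraceStep x i IH a = ∃[ v ] (∀ j → v (value j) ≡ IH j)
      × G v ≈[ level v i ] x × G v (level v i) ≡ x (level v i) × v i ≡ a

    traceStep : Baire κ → ∀ i → (Below i → X) → X
    traceStep x i IH with em {P = ∃ (TraceStep x i IH)}
    ... | yes (a , _) = a
    -- An arbitrary value is harmless: by `agree`, the values of `trace x` from stage `i` on affect
    -- its image only from the level of that stage on.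
    ... | no _ = u₀ i

    traceStep-spec : ∀ {x i IH a} → TraceStep x i IH a → TraceStep x i IH (traceStep x i IH)
    traceStep-spec {x} {i} {IH} t with em {P = ∃ (TraceStep x i IH)}
    ... | yes (_ , t′) = t′
    ... | no ¬∃ = ⊥-elim (¬∃ (_ , t))

    -- The only candidate for a preimage of x under G; hence s is an initial
    -- segment of some G u iff it is one of G (trace (pad s)).
    trace : Baire κ → K → X
    trace x = proj₁ (<-recursion (traceStep x))

    -- `v` itself is a candidate at stage `i`, so the selected `w` is genuine; both images take the
    -- value of `x` at their common level, and `separate` applies.
    trace-follows : ∀ {x v β} → G v ≈[ β ] x → ∀ i → level v i < β → v ≈[ i ] trace x →
                    v i ≡ trace x i
    trace-follows {x} {v} Gv≈x i lv<β v≈t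
      with traceStep-spec {x} {i} {trace x ∘ value}
             (v , (λ j → v≈t (below< j)) , ≈-mono (<⇒≤ lv<β) Gv≈x , Gv≈x lv<β , refl)
    ... | w , w≈t , _ , Gw≡x , wi≡ = trans
      (separate v≈w (trans (Gv≈x lv<β)
        (trans (cong x (level-cong v≈w))
          (trans (sym Gw≡x) (cong (G w) (sym (level-cong v≈w)))))))
      (trans wi≡ (sym (proj₂ (<-recursion (traceStep x)) i)))
      where
      v≈w : v ≈[ i ] w
      v≈w j<i = trans (v≈t j<i) (sym (w≈t (_ , [ j<i ])))

    -- At the first difference `i` of `v` and `trace x`, `trace-follows` forces `β ≤ level v i`, so
    -- by `agree` the two images coincide below `β`.
    trace-≈ : ∀ {x v β} → G v ≈[ β ] x → G (trace x) ≈[ β ] x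
    trace-≈ {x} {v} {β} Gv≈x with em {P = v ≡ trace x}
    ... | yes refl = Gv≈x
    ... | no v≢t =
      let i , v≈t , vi≢ti = firstDifference v≢t
          β≤lv = ≮⇒≥ λ lv<β → vi≢ti (trace-follows Gv≈x i lv<β v≈t)
      in ≈-trans (≈-mono β≤lv (≈-sym (agree v≈t))) Gv≈x

    -- Stated with `trace` in place of an existential over `u`, this stays in universe `ℓ` for every
    -- `X`, and for unions and branches one preimage serves all approximations.
    Tree : Pred (Seq κ) ℓ
    Tree s = G (trace (pad s)) ≈[ length s ] pad s

    G↾∈Tree : ∀ u α → G u ↿ α ∈ Tree
    G↾∈Tree u α = trace-≈ {v = u} (≈-sym (↾-pad (G u) α))

    Tree-node : ∀ {s} → s ∈ Tree → ∃[ u ] s ≡ G u ↿ length s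
    Tree-node {s} s∈S = trace (pad s) , trans (sym (pad-↾ s)) (↾-cong (≈-sym s∈S))

    Tree-subtree : Subtree κ Tree
    Tree-subtree {s} {t} s⊑t t∈S = trace-≈ {v = trace (pad t)}
      (≈-trans (≈-mono (⊑⇒≤ s t s⊑t) t∈S) (⊑⇒≈ s t s⊑t))

    Tree-superclosed : Superclosed κ Tree
    Tree-superclosed s s∈S s-inc u (s⊑u , u⊆s) {β} β<u with u⊆s β β<u
    ... | i , β<si = trace-≈ {v = trace (pad (s i))}
      (≈-trans (s∈S i) (≈-sym (⊑⇒≈ (s i) u (s⊑u i)))) β<si

    Tree-branches : ∀ {x} → x ∈ Branches κ Tree → ∃[ u ] x ≡ G u
    Tree-branches {x} x∈S = trace x , ext λ β →
      let α , β<α = noMax β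
          Gt≈x = ≈-trans (x∈S α) (↾-pad x α)
      in sym (trace-≈ {v = trace (pad (x ↿ α))} Gt≈x β<α)

    -- Changing `u` only at `i = length t` keeps the image fixed below `level u i`, which is at
    -- least `length t`, and gives different values there for different `a`.
    Tree-splitting : Splitting κ X Tree
    Tree-splitting {t} t∈S = s , G↾∈Tree u β , t⊑s , mk↣ succ-injective
      where
      u = trace (pad t)
      i = length t
      β = level u i
      s = G u ↿ β
      t⊑s : t ⊑′ s
      t⊑s = ≈⇒⊑ t s (i≤level u i)
        (≈-trans (≈-sym t∈S) (≈-sym (≈-mono (i≤level u i) (↾-pad (G u) β))))
      β⁺ : ∃[ γ ] (β < γ × (∀ {δ} → δ < γ → ¬ β < δ))
      β⁺ = least (noMax β)
      γ = proj₁ β⁺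
      β<γ : β < γ
      β<γ = proj₁ (proj₂ β⁺)
      β⋖γ : _⋖_ κ β γ
      β⋖γ = β<γ , λ δ β<δ δ<γ → proj₂ (proj₂ β⁺) δ<γ β<δ
      v : X → K → X
      v a = u [ i ≔ a ]
      v≈u : ∀ a → v a ≈[ i ] u
      v≈u a = update-≈ u i
      succ : X → ImmediateSuccessors κ Tree s
      succ a = G (v a) ↿ γ , [ G↾∈Tree (v a) γ , ↾-⊑ (<⇒≤ β<γ) (agree (≈-sym (v≈u a))) , β⋖γ ]
      succ-injective : ∀ {a b} → succ a ≡ succ b → a ≡ b
      succ-injective {a} {b} eq = trans (sym (updated u i)) (trans
        (separate va≈vb (↾-injective (cong value eq)
          (subst (_< γ) (level-cong (≈-sym (v≈u a))) β<γ)))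
        (updated u i))
        where
        va≈vb : v a ≈[ i ] v b
        va≈vb = ≈-trans (v≈u a) (≈-sym (v≈u b))

  opaque
    Scheme⇒Tree : (∀ α → ∃[ β ] α < β) → K → ∀ {x} {X : Set x} {G : (K → X) → Baire κ} →
                  Scheme X G → X → Σ[ S ∈ Pred (Seq κ) ℓ ]
                    (Satisfiable S × Subtree κ S × Superclosed κ S × Splitting κ X S)
                    × (∀ {s} → s ∈ S → ∃[ u ] s ≡ G u ↿ length s)
                    × (∀ {x} → x ∈ Branches κ S → ∃[ u ] x ≡ G u)
    Scheme⇒Tree noMax o {G = G} scheme a = Tree ,
      ((G (λ _ → a) ↿ o , G↾∈Tree _ o) , Tree-subtree , Tree-superclosed , Tree-splitting) ,
      Tree-node , Tree-branches
      where open SchemeTree noMax scheme (λ _ → a)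

  -- Regularity of `κ`.

  module Regular (uncountable : Uncountable κ) (code : κ^<κ≡κ κ) where

    decode : K → Seq κ
    decode = Inverse.from code

    decode-surjective : ∀ s → ∃[ γ ] decode γ ≡ s
    decode-surjective s = Inverse.to code s , Inverse.strictlyInverseʳ code s

    code-injective : ∀ {s t} → Inverse.to code s ≡ Inverse.to code t → s ≡ t
    code-injective {s} {t} eq = trans (sym (Inverse.strictlyInverseʳ code s))
      (trans (cong decode eq) (Inverse.strictlyInverseʳ code t))

    inhabited : K
    inhabited = byContradiction λ empty → uncountable (mk↣ {to = λ α → ⊥-elim (empty α)}
      λ {α} _ → ⊥-elim (empty α))

    distinct : ∃[ α ] ∃[ β ] α < β
    distinct = byContradiction λ ¬distinct → uncountable (mk↣ {to = λ _ → 0}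
      λ {α} {β} _ → ≤-antisym (≮⇒≥ λ β<α → ¬distinct (β , α , β<α))
                              (≮⇒≥ λ α<β → ¬distinct (α , β , α<β)))

    distinct-≢ : proj₁ distinct ≢ proj₁ (proj₂ distinct)
    distinct-≢ eq = <-irrefl eq (proj₂ (proj₂ distinct))

    -- The constant sequences of a fixed nonzero length inject K properly into
    -- ^{<κ}κ, so K injects properly into itself; a maximum of K could be moved
    -- into the gap, contradicting initiality.
    opaque
      noMax : ∀ α → ∃[ β ] α < β
      noMax α = byContradiction λ ¬∃ → initial α (mk↣ {to = to ¬∃} (to-injective ¬∃))
        where
        δ ε : K
        δ = proj₁ distinct
        ε = proj₁ (proj₂ distinct)
        δ<ε : δ < ε
        δ<ε = proj₂ (proj₂ distinct)
        p : K
        p = Inverse.to code (mkSeq δ λ _ → δ)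
        j : K → K
        j ξ = Inverse.to code (mkSeq ε λ _ → ξ)
        j-injective : ∀ {ξ η} → j ξ ≡ j η → ξ ≡ η
        j-injective {ξ} {η} eq = ↾-injective {x = λ _ → ξ} {y = λ _ → η} (code-injective eq) δ<ε
        p≢j : ∀ ξ → p ≢ j ξ
        p≢j ξ eq = <-irrefl (cong length (code-injective eq)) δ<ε
        below : ¬ (∃[ β ] α < β) → ∀ {β} → β ≢ α → β < α
        below ¬∃ {β} β≢α with compare β α
        ... | tri< β<α _ _ = β<α
        ... | tri≈ _ β≡α _ = ⊥-elim (β≢α β≡α)
        ... | tri> _ _ α<β = ⊥-elim (¬∃ (β , α<β))
        swap : ∀ ξ → ∃[ β ] β ≢ α × ((j ξ ≡ α × β ≡ p) ⊎ β ≡ j ξ)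
        swap ξ with em {P = j ξ ≡ α}
        ... | yes jξ≡α = p , (λ p≡α → p≢j ξ (trans p≡α (sym jξ≡α))) , inj₁ (jξ≡α , refl)
        ... | no jξ≢α = j ξ , jξ≢α , inj₂ refl
        to : ¬ (∃[ β ] α < β) → K → Below α
        to ¬∃ ξ = proj₁ (swap ξ) , [ below ¬∃ (proj₁ (proj₂ (swap ξ))) ]
        to-injective : ∀ ¬∃ {ξ η} → to ¬∃ ξ ≡ to ¬∃ η → ξ ≡ η
        to-injective ¬∃ {ξ} {η} eq with swap ξ | swap η | cong value eq
        ... | _ , _ , inj₁ (jξ≡α , _) | _ , _ , inj₁ (jη≡α , _) | _ =
          j-injective (trans jξ≡α (sym jη≡α))
        ... | _ , _ , inj₁ (_ , refl) | _ , _ , inj₂ refl | p≡jη = ⊥-elim (p≢j η p≡jη)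
        ... | _ , _ , inj₂ refl | _ , _ , inj₁ (_ , refl) | jξ≡p = ⊥-elim (p≢j ξ (sym jξ≡p))
        ... | _ , _ , inj₂ refl | _ , _ , inj₂ refl | jξ≡jη = j-injective jξ≡jη

    -- Otherwise a choice of preimages would inject `K` into `Below α`, against `initial`.
    missedValue : ∀ α (φ : K → K) → ∃[ ξ ] (∀ {γ} → γ < α → φ γ ≢ ξ)
    missedValue α φ = byContradiction λ ¬∃ →
      let preimage : ∀ ξ → ∃[ γ ] γ < α × φ γ ≡ ξ
          preimage ξ = byContradiction λ ¬γ → ¬∃ (ξ , λ γ<α eq → ¬γ (_ , γ<α , eq))
      in initial α (mk↣ {to = λ ξ → proj₁ (preimage ξ) , [ proj₁ (proj₂ (preimage ξ)) ]}
           λ {ξ} {η} eq → trans (sym (proj₂ (proj₂ (preimage ξ))))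
             (trans (cong φ (cong value eq)) (proj₂ (proj₂ (preimage η)))))

    -- König: if f were cofinal, diagonalising against the sequences coded up to
    -- f i at argument i would yield an uncoded sequence.
    opaque
      bounded : ∀ {α} (f : Below α → K) → ∃[ δ ] (∀ i → f i < δ)
      bounded {α} f = byContradiction λ unbounded →
        let γ , γ-codes = decode-surjective diagonal
            i , fi≮γ⁺ = ¬∀⇒∃¬ (λ below → unbounded (proj₁ (noMax γ) , below))
            γ<fi⁺ = ≤-<-trans (λ δ<γ → ≮⇒≥ fi≮γ⁺ (<-trans δ<γ (proj₂ (noMax γ))))
                      (proj₂ (noMax (f i)))
        in proj₂ (missed i) γ<fi⁺ (trans (cong (λ s → pad s (value i)) γ-codes) (pad-at diagonal i))
        where
        missed : ∀ i → ∃[ ξ ] (∀ {γ} → γ < proj₁ (noMax (f i)) → pad (decode γ) (value i) ≢ ξ)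
        missed i = missedValue (proj₁ (noMax (f i))) (λ γ → pad (decode γ) (value i))
        diagonal : Seq κ
        diagonal = mkSeq α (proj₁ ∘ missed)

    opaque
      supremum : ∀ {α} (f : Below α → K) →
                 ∃[ δ ] (∀ i → f i ≤ δ) × (∀ {γ} → γ < δ → ∃[ i ] γ < f i)
      supremum {α} f = δ , upper , λ {γ} γ<δ → byContradiction λ ¬∃ →
        min γ<δ λ i → ≮⇒≥ λ γ<fi → ¬∃ (i , γ<fi)
        where
        UpperBound : Pred K ℓ
        UpperBound δ = ∀ i → f i ≤ δ
        supr : ∃[ δ ] UpperBound δ × (∀ {γ} → γ < δ → ¬ UpperBound γ)
        supr = least (proj₁ (bounded f) , λ i {_} → <⇒≤ (proj₂ (bounded f) i))
        δ : K
        δ = proj₁ supr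
        upper : UpperBound δ
        upper = proj₁ (proj₂ supr)
        min : ∀ {γ} → γ < δ → ¬ UpperBound γ
        min = proj₂ (proj₂ supr)

    maximum : ∀ α β → ∃[ γ ] α ≤ γ × β ≤ γ
    maximum α β with ≤-total α β
    ... | inj₁ α≤β = β , α≤β , id
    ... | inj₂ β≤α = α , id , β≤α

    Unbounded : ∀ {p} → Pred K p → Set (ℓ ⊔ p)
    Unbounded P = ∀ α → ∃[ β ] α ≤ β × P β

    ¬Unbounded⇒bound : ∀ {p} {P : Pred K p} → ¬ Unbounded P → ∃[ α ] (∀ {β} → P β → β < α)
    ¬Unbounded⇒bound ¬unb with ¬∀⇒∃¬ ¬unb
    ... | α , none = α , λ {β} Pβ → byContradiction λ β≮α → none (β , ≮⇒≥ β≮α , Pβ)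

    opaque
      -- Regularity bounds the earlier values at each stage; taking the next one at or above that
      -- bound makes `f` strictly increasing.
      enumerate : ∀ {p} {P : Pred K p} → Unbounded P →
                  Σ[ f ∈ (K → K) ] (∀ α → P (f α)) × (∀ {α β} → f α ≡ f β → α ≡ β)
      enumerate {P = P} unb = f , P-f , λ {α} {β} → f-injective
        where
        step : ∀ i → (Below i → K) → K
        step i IH = proj₁ (unb (proj₁ (bounded IH)))
        f : K → K
        f = proj₁ (<-recursion step)
        f-step : ∀ i → f i ≡ step i (f ∘ value)
        f-step = proj₂ (<-recursion step)
        P-f : ∀ i → P (f i)
        P-f i = subst P (sym (f-step i)) (proj₂ (proj₂ (unb _)))
        f-mono : ∀ {i j} → i < j → f i < f j
        f-mono {i} {j} i<j = subst (f i <_) (sym (f-step j))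
          (proj₁ (proj₂ (unb _)) (proj₂ (bounded (f ∘ value)) (i , [ i<j ])))
        f-injective : ∀ {i j} → f i ≡ f j → i ≡ j
        f-injective {i} {j} eq with compare i j
        ... | tri< i<j _ _ = ⊥-elim (<-irrefl eq (f-mono i<j))
        ... | tri≈ _ i≡j _ = i≡j
        ... | tri> _ _ j<i = ⊥-elim (<-irrefl (sym eq) (f-mono j<i))

    -- Fusion along splitting nodes.

    -- F ∘ branch is a Scheme for X, provided that every node of T splits in the
    -- sense of IsSplit; the node chosen for u ↾ i is the union of those chosen for
    -- the u ↾ j with j < i, and superclosure keeps it in T.
    module Fusion {x} {X : Set x} {a₀ a₁ : X} (a₀≢a₁ : a₀ ≢ a₁)
                  {T : Pred (Seq κ) ℓ} (T-subtree : Subtree κ T)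
                  (T-superclosed : Superclosed κ T) (F : Baire κ → Baire κ) where

      -- A node is given as a pair `(p , α)` standing for `p ↾ α`. Its `a`-th child is `point a` cut
      -- at `depth a`; `level` is where the images of distinct children part.
      record Children : Set (ℓ ⊔ x) where
        field
          level : K
          point : X → Baire κ
          depth : X → K

      -- The last three fields quantify over all extensions of the children, not just their
      -- representatives, so that they apply to the limit branches.
      record IsSplit (p : Baire κ) (α : K) (𝕔 : Children) : Set (ℓ ⊔ x) where
        open Children 𝕔
        field
          extends  : ∀ a → point a ≈[ α ] p
          deeper   : ∀ a → α < depth a
          inTree   : ∀ a → point a ↿ depth a ∈ T
          agree    : ∀ {a b y z} → y ≈[ depth a ] point a → z ≈[ depth b ] point b →
                     F y ≈[ level ] F z
          same     : ∀ {a y z} → y ≈[ depth a ] point a → z ≈[ depth a ] point a →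
                     F y level ≡ F z level
          separate : ∀ {a b y z} → y ≈[ depth a ] point a → z ≈[ depth b ] point b →
                     F y level ≡ F z level → a ≡ b

      module _ (splits : ∀ p α → p ↿ α ∈ T → ∃[ 𝕔 ] IsSplit p α 𝕔) where
        open Children

        split : Baire κ × K → Children
        split (p , α) with em {P = ∃ (IsSplit p α)}
        ... | yes (𝕔 , _) = 𝕔
        -- Junk off the tree: with `split` total, `path` can be defined by recursion first, and
        -- `invariant` shows afterwards that the junk never occurs.
        ... | no _ = record { level = α ; point = λ _ → p ; depth = λ _ → α }

        split-spec : ∀ {p α} → p ↿ α ∈ T → IsSplit p α (split (p , α))
        split-spec {p} {α} p∈T with em {P = ∃ (IsSplit p α)}
        ... | yes (_ , is) = is
        ... | no ¬∃ = ⊥-elim (¬∃ (splits p α p∈T))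

        glue : ∀ {i} → (Below i → Baire κ × K) → Baire κ
        glue f γ with em {P = ∃[ j ] γ < proj₂ (f j)}
        ... | yes (j , _) = proj₁ (f j) γ
        ... | no _ = γ

        Coherent : ∀ {i} → (Below i → Baire κ × K) → Set ℓ
        Coherent f = ∀ j k → value j < value k →
          proj₁ (f k) ≈[ proj₂ (f j) ] proj₁ (f j) × proj₂ (f j) < proj₂ (f k)

        glue-≈ : ∀ {i} {f : Below i → Baire κ × K} → Coherent f →
                 ∀ j → glue f ≈[ proj₂ (f j) ] proj₁ (f j)
        glue-≈ {f = f} coh j {γ} γ<j with em {P = ∃[ j ] γ < proj₂ (f j)}
        ... | no ¬∃ = ⊥-elim (¬∃ (j , γ<j))
        ... | yes (k , γ<k) with compare (value j) (value k)
        ...   | tri< j<k _ _ = proj₁ (coh j k j<k) γ<j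
        ...   | tri≈ _ refl _ = refl
        ...   | tri> _ _ k<j = sym (proj₁ (coh k j k<j) γ<k)

        -- For a coherent family this is the empty node at stage zero and the previous child at a
        -- successor, so the recursion needs only one clause.
        limit : ∀ {i} → (Below i → Baire κ × K) → Baire κ × K
        limit f = glue f , proj₁ (supremum (proj₂ ∘ f))

        limit∈T : ∀ {i} {f : Below i → Baire κ × K} → Coherent f →
                  (∀ j → proj₁ (f j) ↿ proj₂ (f j) ∈ T) →
                  proj₁ (limit f) ↿ proj₂ (limit f) ∈ T
        limit∈T {f = f} coh f∈T = T-superclosed (λ j → glue f ↿ proj₂ (f j))
          (λ j → subst T (sym (↾-cong (glue-≈ coh j))) (f∈T j))
          (λ j k j<k → ↾-⊑ (<⇒≤ (proj₂ (coh j k j<k))) λ _ → refl)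
          (glue f ↿ proj₂ (limit f))
          ( (λ j → ↾-⊑ (proj₁ (proj₂ (supremum (proj₂ ∘ f))) j) λ _ → refl)
          , λ β β<λ → proj₂ (proj₂ (supremum (proj₂ ∘ f))) β<λ)

        step : (K → X) → ∀ i → (Below i → Baire κ × K) → Baire κ × K
        step u i IH = point (split (limit IH)) (u i) , depth (split (limit IH)) (u i)

        path : (K → X) → K → Baire κ × K
        path u = proj₁ (<-recursion (step u))

        node : (K → X) → K → Baire κ × K
        node u i = limit {i} (path u ∘ value)

        children : (K → X) → K → Children
        children u i = split (node u i)

        path-step : ∀ u i → path u i ≡ (point (children u i) (u i) , depth (children u i) (u i))
        path-step u = proj₂ (<-recursion (step u))

        path-cong : ∀ {u v} i → u ≈[ i ] v → node u i ≡ node v i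
        path-cong {u} {v} = <-induction _ λ i IH u≈v → cong limit (ext λ j →
          let j<i = below< j in begin
            path u (value j)   ≡⟨ path-step u (value j) ⟩
            _                  ≡⟨ cong₂ (λ n a → point (split n) a , depth (split n) a)
                                    (IH j<i (≈-mono (<⇒≤ j<i) u≈v)) (u≈v j<i) ⟩
            _                  ≡⟨ path-step v (value j) ⟨
            path v (value j)   ∎)
          where open ≡-Reasoning

        module _ (u : K → X) where

          c : K → Baire κ
          c = proj₁ ∘ path u

          d : K → K
          d = proj₂ ∘ path u

          record Invariant (i : K) : Set (ℓ ⊔ x) where
            field
              coherent : ∀ {j} → j < i → c i ≈[ d j ] c j × d j < d i
              c∈T      : c i ↿ d i ∈ T
              isSplit  : IsSplit (proj₁ (node u i)) (proj₂ (node u i)) (children u i)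
              node-≈   : ∀ {j} → j < i → proj₁ (node u i) ≈[ d j ] c j
              d≤node   : ∀ {j} → j < i → d j ≤ proj₂ (node u i)

          -- Coherence of the earlier stages puts their limit in `T`, so the children chosen there
          -- really split; `extends` and `deeper` then carry coherence to stage `i`.
          invariant : ∀ i → Invariant i
          invariant = <-induction Invariant λ i IH →
            let coh : Coherent {i} (path u ∘ value)
                coh j k j<k = Invariant.coherent (IH (below< k)) j<k
                is = split-spec (limit∈T coh λ j → Invariant.c∈T (IH (below< j)))
                node-≈ : ∀ {j} → j < i → proj₁ (node u i) ≈[ d j ] c j
                node-≈ j<i = glue-≈ coh (_ , [ j<i ])
                d≤node : ∀ {j} → j < i → d j ≤ proj₂ (node u i)
                d≤node {j} j<i = proj₁ (proj₂ (supremum {i} (d ∘ value))) (j , [ j<i ])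
                c≡ = cong proj₁ (path-step u i)
                d≡ = cong proj₂ (path-step u i)
            in record
              { coherent = λ j<i →
                  (λ {γ} γ<dj → trans (cong (λ f → f γ) c≡)
                    (trans (IsSplit.extends is (u i) (d≤node j<i γ<dj)) (node-≈ j<i γ<dj))) ,
                  ≤-<-trans (d≤node j<i)
                    (subst (proj₂ (node u i) <_) (sym d≡) (IsSplit.deeper is (u i)))
              ; c∈T = subst (λ n → proj₁ n ↿ proj₂ n ∈ T) (sym (path-step u i))
                  (IsSplit.inTree is (u i))
              ; isSplit = is
              ; node-≈ = node-≈
              ; d≤node = d≤node
              }

          open module Inv i = Invariant (invariant i) public

          i<d : ∀ i → i < d i
          i<d = <-induction _ λ i IH → ≤-<-trans
            (λ j<i → d≤node i j<i (IH j<i))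
            (subst (proj₂ (node u i) <_) (sym (cong proj₂ (path-step u i)))
              (IsSplit.deeper (isSplit i) (u i)))

          -- Since γ < d γ, the approximations c i with i ≥ γ all agree at γ.
          branch : Baire κ
          branch γ = c γ γ

          branch-≈ : ∀ i → branch ≈[ d i ] c i
          branch-≈ i {γ} γ<di with compare γ i
          ... | tri< γ<i _ _ = sym (proj₁ (coherent i γ<i) (i<d γ))
          ... | tri≈ _ refl _ = refl
          ... | tri> _ _ i<γ = proj₁ (coherent γ i<γ) γ<di

          branch-point : ∀ i → branch ≈[ depth (children u i) (u i) ] point (children u i) (u i)
          branch-point i = subst (λ n → branch ≈[ proj₂ n ] proj₁ n) (path-step u i) (branch-≈ i)

          branch∈T : branch ∈ Branches κ T
          branch∈T α = T-subtree (↾-⊑ (<⇒≤ (i<d α)) (≈-mono (<⇒≤ (i<d α)) (branch-≈ α))) (c∈T α)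

          σ : K → K
          σ i = level (children u i)

          later-child-≈ : ∀ {i j} → i < j → ∀ a →
            point (children u j) a ≈[ depth (children u i) (u i) ] point (children u i) (u i)
          later-child-≈ {i} {j} i<j a = subst (λ n → point (children u j) a ≈[ proj₂ n ] proj₁ n)
            (path-step u i)
            λ γ<di → trans (IsSplit.extends (isSplit j) a (d≤node j i<j γ<di)) (node-≈ j i<j γ<di)

          -- At stage `j` the children for `a₀` and `a₁` both extend the child taken at stage `i`,
          -- so by `agree` and `same` their images coincide up to and including `σ i`; yet they
          -- differ at `σ j`.
          σ-increasing : ∀ {i j} → i < j → σ i < σ j
          σ-increasing {i} {j} i<j = byContradiction λ σi≮σj →
            a₀≢a₁ (IsSplit.separate (isSplit j) (λ _ → refl) (λ _ → refl) (agree-at (≮⇒≥ σi≮σj)))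
            where
            y₀ = point (children u j) a₀
            y₁ = point (children u j) a₁
            agree-at : σ j ≤ σ i → F y₀ (σ j) ≡ F y₁ (σ j)
            agree-at σj≤σi with compare (σ j) (σ i)
            ... | tri< σj<σi _ _ =
              IsSplit.agree (isSplit i) (later-child-≈ i<j a₀) (later-child-≈ i<j a₁) σj<σi
            ... | tri≈ _ σj≡σi _ = subst (λ k → F y₀ k ≡ F y₁ k) (sym σj≡σi)
              (IsSplit.same (isSplit i) (later-child-≈ i<j a₀) (later-child-≈ i<j a₁))
            ... | tri> _ _ σi<σj = ⊥-elim (≤⇒≯ σj≤σi σi<σj)

          i≤σ : ∀ i → i ≤ σ i
          i≤σ = <-induction _ λ i IH j<i → ≤-<-trans (IH j<i) (σ-increasing j<i)

        fusion : Scheme X (F ∘ branch)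
        fusion = record
          { level      = σ
          ; level-cong = λ {u} {v} {i} u≈v → cong (level ∘ split) (path-cong i u≈v)
          ; i≤level    = i≤σ
          ; agree      = λ {u} {v} {i} u≈v →
              IsSplit.agree (isSplit u i) (branch-point u i) (transport u≈v)
          ; separate   = λ {u} {v} {i} u≈v →
              IsSplit.separate (isSplit u i) (branch-point u i) (transport u≈v)
          }
          where
          -- `u` and `v` share the node at stage `i`, so both branches pass through children of one
          -- and the same split.
          transport : ∀ {u v i} → u ≈[ i ] v →
            branch v ≈[ depth (children u i) (v i) ] point (children u i) (v i)
          transport {u} {v} {i} u≈v = subst
            (λ n → branch v ≈[ depth (split n) (v i) ] point (split n) (v i))
            (sym (path-cong i u≈v)) (branch-point v i)

    -- Continuity in terms of moduli; preimages of `Σ¹₁` sets.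

    Modulus : ∀ {a b} {A : Set a} {B : Set b} → ((K → A) → K → B) → Set (ℓ ⊔ a ⊔ b)
    Modulus f = ∀ x β → ∃[ α ] (∀ {y} → y ≈[ α ] x → f y ≈[ β ] f x)

    Modulus-∘ : ∀ {a b c} {A : Set a} {B : Set b} {C : Set c}
                {f : (K → B) → K → C} {g : (K → A) → K → B} →
                Modulus f → Modulus g → Modulus (f ∘ g)
    Modulus-∘ {g = g} f-mod g-mod x γ =
      let β , f≈ = f-mod (g x) γ
          α , g≈ = g-mod x β
      in α , λ y≈x → f≈ (g≈ y≈x)

    Scheme⇒Modulus : ∀ {x} {X : Set x} {G : (K → X) → Baire κ} → Scheme X G → Modulus G
    Scheme⇒Modulus scheme u β = β , λ {v} v≈u → ≈-mono (i≤level v β) (agree v≈u)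
      where open Scheme scheme

    N : Seq κ → Pred (Baire κ) ℓ
    N = Space.N (BaireSpace κ)

    N⇒≈ : ∀ {s x y} → x ∈ N s → y ∈ N s → y ≈[ length s ] x
    N⇒≈ x∈N y∈N β<s = trans (y∈N (_ , [ β<s ])) (sym (x∈N (_ , [ β<s ])))

    ≈⇒N : ∀ {s x y} → x ∈ N s → y ≈[ length s ] x → y ∈ N s
    ≈⇒N x∈N y≈x i = trans (y≈x (below< i)) (x∈N i)

    -- The product of `f` with the identity is continuous, so it pulls the closed set `C` back to a
    -- closed set.
    Σ¹₁-preimage : ∀ {f A} → Modulus f → Σ¹₁ κ A → Σ¹₁ κ (f ⊢ A)
    Σ¹₁-preimage {f} f-mod (C , C-closed , A⊆ , ⊆A) =
      (λ (x , y) → C (f x , y)) ,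
      (λ {(x , y)} xy∉C →
        let (s , t) , (fx∈s , y∈t) , s×t⊆∁C = C-closed xy∉C
            α , f≈ = f-mod x (length s)
        in (x ↿ α , t) , ((λ _ → refl) , y∈t) , λ {(x′ , y′)} (x′∈ , y′∈t) →
          s×t⊆∁C (≈⇒N {s} fx∈s (f≈ (N⇒≈ {x ↿ α} {x} (λ _ → refl) x′∈)) , y′∈t)) ,
      A⊆ , ⊆A

    -- Schemes inside trees and along continuous maps.

    module _ {x} {X : Set x} {a₀ a₁ : X} (a₀≢a₁ : a₀ ≢ a₁) where

      opaque
        -- Fusion with `F = id`: the children of a node are the given immediate successors of a
        -- splitting node `s` above it, and they part at `length s`.
        treeScheme : ∀ {T} → Satisfiable T × Subtree κ T × Superclosed κ T × Splitting κ X T →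
                     ∃[ G ] Scheme X G × (∀ u → G u ∈ Branches κ T)
        treeScheme {T} (_ , T-sub , T-sup , T-split) =
          branch splits , fusion splits , branch∈T splits
          where
          open Fusion a₀≢a₁ T-sub T-sup id
          splits : ∀ p α → p ↿ α ∈ T → ∃[ 𝕔 ] IsSplit p α 𝕔
          splits p α p∈T with T-split p∈T
          ... | s , s∈T , p⊑s , inj =
            record { level = length s ; point = point ; depth = depth } , record
            { extends = λ a → ≈-trans (≈-mono α≤s (point-≈ a))
                (≈-trans (⊑⇒≈ (p ↿ α) s p⊑s) (↾-pad p α))
            ; deeper = λ a → ≤-<-trans α≤s (proj₁ (s⋖ a))
            ; inTree = λ a → subst T (sym (pad-↾ (value (to a)))) (proj₁ (spec a))
            ; agree = λ {a} {b} y≈ z≈ → ≈-trans (below-s a y≈) (≈-sym (below-s b z≈))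
            ; same = λ {a} y≈ z≈ → trans (at-s a y≈) (sym (at-s a z≈))
            ; separate = λ {a} {b} y≈ z≈ eq → injective (value-injective (begin
                value (to a)        ≡⟨ pad-↾ (value (to a)) ⟨
                point a ↿ depth a   ≡⟨ ↾-cong (points-≈ a b
                                         (trans (sym (at-s a y≈)) (trans eq (at-s b z≈)))) ⟩
                point b ↿ depth a   ≡⟨ cong (point b ↿_) (depth-≡ a b) ⟩
                point b ↿ depth b   ≡⟨ pad-↾ (value (to b)) ⟩
                value (to b)        ∎))
            }
            where
            open Injection inj using (to; injective)
            open ≡-Reasoning
            point : X → Baire κ
            point a = pad (value (to a))
            depth : X → K
            depth a = length (value (to a))
            spec : ∀ a → value (to a) ∈ T × s ⊑′ value (to a) × _⋖_ κ (length s) (depth a)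
            spec a with to a
            ... | _ , [ pf ] = recompute em pf
            s⋖ : ∀ a → _⋖_ κ (length s) (depth a)
            s⋖ a = proj₂ (proj₂ (spec a))
            α≤s : α ≤ length s
            α≤s = ⊑⇒≤ (p ↿ α) s p⊑s
            point-≈ : ∀ a → point a ≈[ length s ] pad s
            point-≈ a = ⊑⇒≈ s (value (to a)) (proj₁ (proj₂ (spec a)))
            below-s : ∀ a {y} → y ≈[ depth a ] point a → y ≈[ length s ] pad s
            below-s a y≈ = ≈-trans (≈-mono (<⇒≤ (proj₁ (s⋖ a))) y≈) (point-≈ a)
            at-s : ∀ a {y} → y ≈[ depth a ] point a → y (length s) ≡ point a (length s)
            at-s a y≈ = y≈ (proj₁ (s⋖ a))
            depth-≡ : ∀ a b → depth a ≡ depth b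
            depth-≡ a b = ≤-antisym (≮⇒≥ λ b<a → proj₂ (s⋖ a) _ (proj₁ (s⋖ b)) b<a)
                                    (≮⇒≥ λ a<b → proj₂ (s⋖ b) _ (proj₁ (s⋖ a)) a<b)
            -- The length of a child is the successor of `length s`, so the value at `length s` is
            -- the only one not inherited from `s`.
            points-≈ : ∀ a b → point a (length s) ≡ point b (length s) →
                       point a ≈[ depth a ] point b
            points-≈ a b eq {γ} γ<a with compare γ (length s)
            ... | tri< γ<s _ _ = trans (point-≈ a γ<s) (sym (point-≈ b γ<s))
            ... | tri≈ _ refl _ = eq
            ... | tri> _ _ s<γ = ⊥-elim (proj₂ (s⋖ a) _ s<γ γ<a)

      LocallySplitting : (Baire κ → Baire κ) → Set (ℓ ⊔ x)
      LocallySplitting F = ∀ p α → ∃[ β ] Σ[ c ∈ (X → Baire κ) ]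
        (∀ a → c a ≈[ α ] p) × (∀ a b → F (c a) ≈[ β ] F (c b)) ×
        (∀ a b → F (c a) β ≡ F (c b) β → a ≡ b)

      opaque
        -- Fusion in the full tree: continuity lets each `depth a` be so large that all extensions
        -- of the child have the same image up to and including `β`.
        mapScheme : ∀ {F} → Modulus F → LocallySplitting F → ∃[ H ] Scheme X (F ∘ H)
        mapScheme {F} F-mod F-split = branch splits , fusion splits
          where
          open Fusion a₀≢a₁ {T = λ _ → ⊤} (λ _ _ → _) (λ _ _ _ _ _ → _) F
          splits : ∀ p α → ⊤ {ℓ} → ∃[ 𝕔 ] IsSplit p α 𝕔
          splits p α _ with F-split p α
          ... | β , c , c≈p , Fc≈ , Fc-sep =
            record { level = β ; point = c ; depth = depth } , record
            { extends = c≈p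
            ; deeper = λ a → proj₁ (proj₂ (deep a))
            ; inTree = λ _ → _
            ; agree = λ {a} {b} y≈ z≈ → ≈-trans (≈-mono (<⇒≤ β<β⁺) (F≈ a y≈))
                (≈-trans (Fc≈ a b) (≈-sym (≈-mono (<⇒≤ β<β⁺) (F≈ b z≈))))
            ; same = λ {a} y≈ z≈ → trans (F≈ a y≈ β<β⁺) (sym (F≈ a z≈ β<β⁺))
            ; separate = λ {a} {b} y≈ z≈ eq →
                Fc-sep a b (trans (sym (F≈ a y≈ β<β⁺)) (trans eq (F≈ b z≈ β<β⁺)))
            }
            where
            -- One step beyond `β`, so that agreement below `β⁺` controls the value at `β` itself.
            β⁺ : K
            β⁺ = proj₁ (noMax β)
            β<β⁺ : β < β⁺
            β<β⁺ = proj₂ (noMax β)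
            deep : ∀ a → ∃[ δ ] α < δ × proj₁ (F-mod (c a) β⁺) ≤ δ
            deep a with maximum (proj₁ (noMax α)) (proj₁ (F-mod (c a) β⁺))
            ... | δ , α⁺≤δ , mod≤δ = δ , α⁺≤δ (proj₂ (noMax α)) , mod≤δ
            depth : X → K
            depth a = proj₁ (deep a)
            F≈ : ∀ a {y} → y ≈[ depth a ] c a → F y ≈[ β⁺ ] F (c a)
            F≈ a y≈ = proj₂ (F-mod (c a) β⁺) (≈-mono (proj₂ (proj₂ (deep a))) y≈)

    -- Binary splitting and the embedding into ^κ 2.

    0≢1 : _≢_ {A = Fin 2} zero (suc zero)
    0≢1 ()

    injective⇒LocallySplitting : ∀ {F} → (∀ {y z} → F y ≡ F z → y ≡ z) → LocallySplitting 0≢1 F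
    injective⇒LocallySplitting {F} F-inj p α with noMax (p α)
    ... | ξ , pα<ξ with firstDifference {x = F p} {y = F (p [ α ≔ ξ ])}
            (λ eq → <-irrefl (trans (cong (λ y → y α) (F-inj eq)) (updated p α)) pα<ξ)
    ...   | β , F≈ , F≢ = β , c , c≈p , Fc≈ , Fc-sep
      where
      c : Fin 2 → Baire κ
      c zero = p
      c (suc zero) = p [ α ≔ ξ ]
      c≈p : ∀ a → c a ≈[ α ] p
      c≈p zero _ = refl
      c≈p (suc zero) = update-≈ p α
      Fc≈ : ∀ a b → F (c a) ≈[ β ] F (c b)
      Fc≈ zero zero _ = refl
      Fc≈ zero (suc zero) = F≈
      Fc≈ (suc zero) zero = ≈-sym F≈
      Fc≈ (suc zero) (suc zero) _ = refl
      Fc-sep : ∀ a b → F (c a) β ≡ F (c b) β → a ≡ b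
      Fc-sep zero zero _ = refl
      Fc-sep zero (suc zero) eq = ⊥-elim (F≢ eq)
      Fc-sep (suc zero) zero eq = ⊥-elim (F≢ (sym eq))
      Fc-sep (suc zero) (suc zero) _ = refl

    indicator : Set ℓ → Fin 2
    indicator P with em {P = P}
    ... | yes _ = suc zero
    ... | no _ = zero

    indicator⁺ : ∀ {P} → P → indicator P ≡ suc zero
    indicator⁺ {P} p with em {P = P}
    ... | yes _ = refl
    ... | no ¬p = ⊥-elim (¬p p)

    indicator⁻ : ∀ {P} → indicator P ≡ suc zero → P
    indicator⁻ {P} _ with em {P = P}
    indicator⁻ _ | yes p = p
    indicator⁻ () | no _

    -- Recording which codes denote initial segments of x embeds ^κ κ into ^κ 2.
    initialSegments : Baire κ → K → Fin 2
    initialSegments x γ = indicator (decode γ ≡ x ↿ length (decode γ))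

    opaque
      -- By regularity the lengths of the sequences coded below `β` are bounded, and only that much
      -- of `x` is consulted.
      initialSegments-modulus : Modulus initialSegments
      initialSegments-modulus x β with bounded {β} (length ∘ decode ∘ value)
      ... | δ , lengths<δ = δ , λ {y} y≈x {γ} γ<β →
        cong (λ s → indicator (decode γ ≡ s)) (↾-cong (≈-mono (<⇒≤ (lengths<δ (γ , [ γ<β ]))) y≈x))

    opaque
      initialSegments-injective : ∀ {x y} → initialSegments x ≡ initialSegments y → x ≡ y
      initialSegments-injective {x} {y} eq = ext λ β →
        let α , β<α = noMax β
            γ , dγ≡x↾α = decode-surjective (x ↿ α)
            length≡ = cong length dγ≡x↾α
            dγ≡y = indicator⁻ (trans (sym (cong (λ u → u γ) eq))
                     (indicator⁺ (trans dγ≡x↾α (cong (x ↿_) (sym length≡)))))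
        in ↾-injective (trans (sym dγ≡x↾α) (trans dγ≡y (cong (y ↿_) length≡))) β<α

    -- K_κ sets, domination and closed embeddings.

    opaque
      -- Regularity applied to a partial inverse of the given injection.
      Size<κ⇒bounded : ∀ {J : Pred K ℓ} → Size<κ κ [ j ∈ K ∣ J j ] →
                       ∃[ δ ] (∀ (j : [ j ∈ K ∣ J j ]) → value j < δ)
      Size<κ⇒bounded {J} (α , inj) = proj₁ (bounded preimage) , λ j →
        subst (_< proj₁ (bounded preimage)) (preimage-to j) (proj₂ (bounded preimage) (to j))
        where
        open Injection inj using (to; injective)
        preimage : Below α → K
        preimage i with em {P = ∃[ j ] to j ≡ i}
        ... | yes (j , _) = value j
        ... | no _ = α
        preimage-to : ∀ j → preimage (to j) ≡ value j
        preimage-to j with em {P = ∃[ k ] to k ≡ to j}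
        ... | yes (_ , eq) = cong value (injective eq)
        ... | no ¬∃ = ⊥-elim (¬∃ (j , refl))

    -- The α-th compact set is bounded at coordinate α by g α.
    opaque
      K-κ⇒undominating : ∀ {B} → K-κ κ B →
                         Σ[ g ∈ (K → K) ] (∀ {x} → (∀ α → g α ≤ x α) → ¬ x ∈ B)
      K-κ⇒undominating {B} (F , F-compact , B⊆ , _) = (λ α → proj₁ (bound α)) , λ {x} g≤x x∈B →
        let α , x∈Fα = B⊆ x∈B in ≤⇒≯ (g≤x α) (proj₂ (bound α) x∈Fα)
        where
        -- For fixed `α` these sets cover ^κ κ as `ξ` varies, so fewer than κ of them cover `F α`,
        -- and their indices are bounded.
        U : K → K → Pred (Baire κ) ℓ
        U α ξ x = x α < ξ
        U-open : ∀ α ξ → Open (BaireSpace κ) (U α ξ)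
        U-open α ξ {x} xα<ξ = x ↿ proj₁ (noMax α) , (λ _ → refl) , λ {y} y∈N →
          subst (_< ξ) (sym (y∈N (α , [ proj₂ (noMax α) ]))) xα<ξ
        bound : ∀ α → ∃[ δ ] (∀ {x} → x ∈ F α → x α < δ)
        bound α with F-compact α K (U α) (U-open α) (λ {x} _ → noMax (x α))
        ... | J , size , cover = proj₁ (Size<κ⇒bounded size) , λ x∈Fα →
          let ξ , xα<ξ = cover x∈Fα in <-trans xα<ξ (proj₂ (Size<κ⇒bounded size) ξ)

    opaque
      -- Each coordinate is mapped on its own by an injection into the ordinals from `g α` on, so
      -- coordinate `i` can serve as level `i`.
      dominator : (g : K → K) → ∃[ M ] Scheme K M × (∀ x α → g α ≤ M x α)
      dominator g = (λ x α → f α (x α)) , record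
        { level = λ _ i → i
        ; level-cong = λ _ → refl
        ; i≤level = λ _ _ → id
        ; agree = λ u≈v {β} β<i → cong (f β) (u≈v β<i)
        ; separate = λ {_} {_} {i} _ eq → proj₂ (proj₂ (enum i)) eq
        } , λ x α → proj₁ (proj₂ (enum α)) (x α)
        where
        enum : ∀ α → Σ[ f ∈ (K → K) ] (∀ ξ → g α ≤ f ξ) × (∀ {ξ η} → f ξ ≡ f η → ξ ≡ η)
        enum α = enumerate {P = λ β → g α ≤ β} λ β → maximum β (g α)
        f : K → K → K
        f α = proj₁ (enum α)

    -- `inverse` is continuity of the inverse on the range, and `closed` says that the range is
    -- closed.
    record ClosedEmbedding (C : Pred (Baire κ) ℓ) (h : Baire κ → Baire κ) : Set ℓ where
      field
        range     : ∀ x → h x ∈ C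
        modulus   : Modulus h
        injective : ∀ {x y} → h x ≡ h y → x ≡ y
        inverse   : ∀ x β → ∃[ α ] (∀ {y} → h y ≈[ α ] h x → y ≈[ β ] x)
        closed    : ∀ y → (∀ α → ∃[ x ] h x ≈[ α ] y) → ∃[ x ] h x ≡ y

    opaque
      homeomorphic⇒ClosedEmbedding : ∀ {C} → Closed (BaireSpace κ) C →
        Homeomorphic (Subspace (BaireSpace κ) C) (BaireSpace κ) → ∃ (ClosedEmbedding C)
      homeomorphic⇒ClosedEmbedding {C} C-closed (f , to-cont , from-cont) = h , record
        { range = range
        ; modulus = λ x β →
            let s , x∈s , s⊆ = from-cont (λ z → value z ∈ N (h x ↿ β))
                  (λ {z} z∈ → h x ↿ β , z∈ , id) {x} (λ _ → refl)
            in length s , λ {y} y≈x → N⇒≈ {h x ↿ β} {h x} {h y} (λ _ → refl) (s⊆ (≈⇒N {s} x∈s y≈x))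
        ; injective = λ {x} {y} hx≡hy → trans (sym (strictlyInverseˡ x))
            (trans (cong to (value-injective hx≡hy)) (strictlyInverseˡ y))
        ; inverse = λ x β →
            let s , x∈s , s⊆ = to-cont (N (x ↿ β)) (λ {z} z∈ → x ↿ β , z∈ , id) {from x}
                  (λ i → cong (λ y → y (value i)) (strictlyInverseˡ x))
            in length s , λ {y} hy≈hx {γ} γ<β → trans (sym (cong (λ y → y γ) (strictlyInverseˡ y)))
                 (s⊆ {from y} (≈⇒N {s} x∈s hy≈hx) (γ , [ γ<β ]))
        ; closed = closed
        }
        where
        open Inverse f using (to; from; strictlyInverseˡ; strictlyInverseʳ)
        h : Baire κ → Baire κ
        h = value ∘ from
        range : ∀ x → h x ∈ C
        range x with from x
        ... | _ , [ y∈C ] = recompute em y∈C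
        closed : ∀ y → (∀ α → ∃[ x ] h x ≈[ α ] y) → ∃[ x ] h x ≡ y
        closed y y-limit = to (y , [ y∈C ]) , cong value (strictlyInverseʳ (y , [ y∈C ]))
          where
          y∈C : y ∈ C
          y∈C = byContradiction λ y∉C →
            let s , y∈s , s⊆∁C = C-closed y∉C
                x , hx≈y = y-limit (length s)
            in s⊆∁C (≈⇒N {s} y∈s hx≈y) (range x)

    -- Weak compactness and κ-splitting of closed embeddings.

    EventuallyConstant : Pred K ℓ → (K → K) → Set ℓ
    EventuallyConstant P v = ∃[ η ] (∀ {ξ ζ} → P ξ → P ζ → η ≤ ξ → η ≤ ζ → v ξ ≡ v ζ)

    -- The least value on `P` is attained at some `ξ*`; from there on, values cannot rise by
    -- hypothesis nor fall by minimality.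
    antitone⇒EventuallyConstant : ∀ {P v} → Satisfiable P →
      (∀ {ξ ζ} → P ξ → P ζ → ξ < ζ → ¬ v ξ < v ζ) → EventuallyConstant P v
    antitone⇒EventuallyConstant {P} {v} (ξ₀ , Pξ₀) anti
      with least {P = λ β → ∃[ ξ ] P ξ × v ξ ≡ β} (v ξ₀ , ξ₀ , Pξ₀ , refl)
    ... | _ , (ξ* , Pξ* , refl) , min = ξ* , λ Pξ Pζ ξ*≤ξ ξ*≤ζ →
      trans (sym (minimal Pξ ξ*≤ξ)) (minimal Pζ ξ*≤ζ)
      where
      minimal : ∀ {ξ} → P ξ → ξ* ≤ ξ → v ξ* ≡ v ξ
      minimal {ξ} Pξ ξ*≤ξ with compare ξ* ξ
      ... | tri≈ _ refl _ = refl
      ... | tri> _ _ ξ<ξ* = ⊥-elim (≤⇒≯ ξ*≤ξ ξ<ξ*)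
      ... | tri< ξ*<ξ _ _ = ≤-antisym (≮⇒≥ λ vξ<vξ* → min vξ<vξ* (ξ , Pξ , refl))
                                      (≮⇒≥ (anti Pξ* Pξ ξ*<ξ))

    -- For each `β < b` that is exceeded at all, fix a place where this happens; regularity bounds
    -- these places by `η`. A rise above `v ξ` after `η ≤ ξ` would mean that `v ξ` was already
    -- exceeded before `ξ`.
    bounded-monotone⇒EventuallyConstant : ∀ {P v} b → (∀ {ξ} → P ξ → v ξ < b) →
      (∀ {ξ ζ} → P ξ → P ζ → ξ < ζ → ¬ v ζ < v ξ) → EventuallyConstant P v
    bounded-monotone⇒EventuallyConstant {P} {v} b v<b mono = η , λ Pξ Pζ η≤ξ η≤ζ →
      ≤-antisym (≮⇒≥ (maximal Pζ Pξ η≤ζ)) (≮⇒≥ (maximal Pξ Pζ η≤ξ))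
      where
      Exceeds : K → K → Set ℓ
      Exceeds β ξ = P ξ × β < v ξ
      witness : Below b → K
      witness (β , _) with em {P = ∃ (Exceeds β)}
      ... | yes (ξ , _) = ξ
      ... | no _ = β
      witness-exceeds : ∀ i {ξ} → Exceeds (value i) ξ → Exceeds (value i) (witness i)
      witness-exceeds (β , _) e with em {P = ∃ (Exceeds β)}
      ... | yes (_ , e′) = e′
      ... | no ¬∃ = ⊥-elim (¬∃ (_ , e))
      η : K
      η = proj₁ (bounded witness)
      maximal : ∀ {ξ ζ} → P ξ → P ζ → η ≤ ξ → ¬ v ξ < v ζ
      maximal {ξ} Pξ Pζ η≤ξ vξ<vζ with witness-exceeds (v ξ , [ v<b Pξ ]) (Pζ , vξ<vζ)
      ... | Pw , vξ<vw = mono Pw Pξ (η≤ξ (proj₂ (bounded witness) _)) vξ<vw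

    ↔⇒Unbounded : ∀ {H : Pred K ℓ} → [ α ∈ K ∣ H α ] ↔ K → Unbounded H
    ↔⇒Unbounded {H} f = byContradiction λ ¬unb → initial (proj₁ (¬Unbounded⇒bound ¬unb))
      (mk↣ {to = embed ¬unb ∘ from} λ {ξ} {ζ} eq → trans (sym (strictlyInverseˡ ξ))
        (trans (cong to (embed-injective ¬unb (from ξ) (from ζ) eq)) (strictlyInverseˡ ζ)))
      where
      open Inverse f using (to; from; strictlyInverseˡ)
      embed : ∀ ¬unb → [ α ∈ K ∣ H α ] → Below (proj₁ (¬Unbounded⇒bound {P = H} ¬unb))
      embed ¬unb (α , [ Hα ]) = α , [ proj₂ (¬Unbounded⇒bound ¬unb) Hα ]
      embed-injective : ∀ ¬unb i j → embed ¬unb i ≡ embed ¬unb j → i ≡ j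
      embed-injective ¬unb i j eq = value-injective (cong value eq)

    Lex : Baire κ → Baire κ → Set ℓ
    Lex y z = ∃[ γ ] y ≈[ γ ] z × y γ < z γ

    ≈∧Lex⇒≯ : ∀ {y z γ} → y ≈[ γ ] z → Lex y z → ¬ z γ < y γ
    ≈∧Lex⇒≯ {y} {z} {γ} y≈z (δ , y≈z′ , yδ<zδ) zγ<yγ with compare δ γ
    ... | tri< δ<γ _ _ = <-irrefl (y≈z δ<γ) yδ<zδ
    ... | tri≈ _ refl _ = <-irrefl refl (<-trans yδ<zδ zγ<yγ)
    ... | tri> _ _ γ<δ = <-irrefl (sym (y≈z′ γ<δ)) zγ<yγ

    module _ (weaklyCompact : WeaklyCompact κ) where

      -- If h did not split above p ↾ α, its values would be bounded at every
      -- node.  A homogeneous set for the lexicographic colouring makes the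
      -- values h (p [ α ≔ ξ ]) lexicographically monotone, so they converge;
      -- but the points p [ α ≔ ξ ] do not.
      embedding⇒LocallySplitting : ∀ {C h} → ClosedEmbedding C h → ∀ {a₀ a₁ : K} (a₀≢a₁ : a₀ ≢ a₁) →
                                   LocallySplitting a₀≢a₁ h
      embedding⇒LocallySplitting {h = h} embedding _ p α = byContradiction divergent
        where
        open ClosedEmbedding embedding
        Splits : Set ℓ
        Splits = ∃[ β ] Σ[ c ∈ (K → Baire κ) ] (∀ a → c a ≈[ α ] p) ×
          (∀ a b → h (c a) ≈[ β ] h (c b)) × (∀ a b → h (c a) β ≡ h (c b) β → a ≡ b)

        y : K → Baire κ
        y ξ = h (p [ α ≔ ξ ])

        colour : K → K → Bool
        colour ξ ζ = does (em {P = Lex (y ξ) (y ζ)})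

        Values : K → Baire κ → Pred K ℓ
        Values γ z v = ∃[ q ] q ≈[ α ] p × h q ≈[ γ ] z × h q γ ≡ v

        module _ (¬splits : ¬ Splits) where

          -- Unboundedly many values would come from κ many points above `p ↾ α` whose images agree
          -- below `γ` and differ at `γ`, so `h` would split.
          values-bounded : ∀ γ z → ∃[ b ] (∀ {v} → Values γ z v → v < b)
          values-bounded γ z = ¬Unbounded⇒bound ¬unbounded
            where
            ¬unbounded : ¬ Unbounded (Values γ z)
            ¬unbounded unb with enumerate unb
            ... | f , f∈V , f-inj = ¬splits (γ , c , c≈p ,
                (λ a b → ≈-trans (hc≈z a) (≈-sym (hc≈z b))) ,
                λ a b eq → f-inj (trans (sym (hcγ≡ a)) (trans eq (hcγ≡ b))))
              where
              c : K → Baire κ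
              c a = proj₁ (f∈V a)
              c≈p : ∀ a → c a ≈[ α ] p
              c≈p a = proj₁ (proj₂ (f∈V a))
              hc≈z : ∀ a → h (c a) ≈[ γ ] z
              hc≈z a = proj₁ (proj₂ (proj₂ (f∈V a)))
              hcγ≡ : ∀ a → h (c a) γ ≡ f a
              hcγ≡ a = proj₂ (proj₂ (proj₂ (f∈V a)))

          module _ (H : Pred K ℓ) (H-unbounded : Unbounded H) where

            Stable : K → Set ℓ
            Stable γ = EventuallyConstant H λ ξ → y ξ γ

            tail : ∀ {γ} → (∀ {δ} → δ < γ → Stable δ) →
                   ∃[ η ] (∀ {ξ ζ} → H ξ → H ζ → η ≤ ξ → η ≤ ζ → y ξ ≈[ γ ] y ζ)
            tail {γ} stable with bounded {γ} (λ i → proj₁ (stable (below< i)))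
            ... | η , <η = η , λ Hξ Hζ η≤ξ η≤ζ {δ} δ<γ →
              proj₂ (stable (below< (δ , [ δ<γ ]))) Hξ Hζ
                (<⇒≤ (η≤ξ (<η (δ , [ δ<γ ])))) (<⇒≤ (η≤ζ (<η (δ , [ δ<γ ]))))

            Homogeneous : Bool → Set ℓ
            Homogeneous b = ∀ {ξ ζ} → H ξ → H ζ → ξ < ζ → colour ξ ζ ≡ b

            Tail : K → Pred K ℓ
            Tail η ξ = H ξ × η ≤ ξ

            -- Where the `y ξ` agree below `γ`, homogeneity makes their values at `γ` non-decreasing
            -- if `b` is `true`, with a bound from `values-bounded`, and non-increasing if it is
            -- `false`.
            tail-constant : ∀ {γ η} b → Homogeneous b →
              (∀ {ξ ζ} → H ξ → H ζ → η ≤ ξ → η ≤ ζ → y ξ ≈[ γ ] y ζ) →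
              EventuallyConstant (Tail η) λ ξ → y ξ γ
            tail-constant {γ} {η} b homogeneous y≈ = constant b homogeneous
              where
              ξ₀ : Satisfiable (Tail η)
              ξ₀ = let ξ , η≤ξ , Hξ = H-unbounded η in ξ , Hξ , η≤ξ
              reflects : ∀ {ξ ζ b} → colour ξ ζ ≡ b → Reflects (Lex (y ξ) (y ζ)) b
              reflects {ξ} {ζ} eq = subst (Reflects (Lex (y ξ) (y ζ))) eq (Dec.proof em)
              constant : ∀ b → Homogeneous b → EventuallyConstant (Tail η) λ ξ → y ξ γ
              constant true homogeneous = bounded-monotone⇒EventuallyConstant (proj₁ bnd)
                (λ {ξ} (Hξ , η≤ξ) → proj₂ bnd (p [ α ≔ ξ ] , update-≈ p α ,
                  y≈ Hξ (proj₁ (proj₂ ξ₀)) η≤ξ (proj₂ (proj₂ ξ₀)) , refl))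
                λ (Hξ , η≤ξ) (Hζ , η≤ζ) ξ<ζ →
                  ≈∧Lex⇒≯ (y≈ Hξ Hζ η≤ξ η≤ζ) (invert (reflects (homogeneous Hξ Hζ ξ<ζ)))
                where
                bnd : ∃[ b ] (∀ {v} → Values γ (y (proj₁ ξ₀)) v → v < b)
                bnd = values-bounded γ (y (proj₁ ξ₀))
              constant false homogeneous = antitone⇒EventuallyConstant ξ₀
                λ (Hξ , η≤ξ) (Hζ , η≤ζ) ξ<ζ lt →
                  invert (reflects (homogeneous Hξ Hζ ξ<ζ)) (γ , y≈ Hξ Hζ η≤ξ η≤ζ , lt)

            stable-step : ∀ b → Homogeneous b → ∀ γ → (∀ {δ} → δ < γ → Stable δ) → Stable γ
            stable-step b homogeneous γ IH with tail IH
            ... | η , y≈ with tail-constant b homogeneous y≈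
            ...   | η′ , const with maximum η η′
            ...     | θ , η≤θ , η′≤θ = θ , λ Hξ Hζ θ≤ξ θ≤ζ →
              const (Hξ , λ {_} → θ≤ξ ∘ η≤θ) (Hζ , λ {_} → θ≤ζ ∘ η≤θ) (θ≤ξ ∘ η′≤θ) (θ≤ζ ∘ η′≤θ)

            -- The pointwise limit `z` lies in the closed range, say `z = h x`; by `inverse`, every
            -- large `ξ` in `H` equals `x α`, yet there are two of them.
            ¬stable : ¬ (∀ γ → Stable γ)
            ¬stable stable =
              <-irrefl (trans (fixed Hξ₁ η≤ξ₁) (sym (fixed Hξ₂ (<⇒≤ ξ₁<ξ₂ ∘ η≤ξ₁)))) ξ₁<ξ₂
              where
              sample : ∀ γ → ∃[ ξ ] proj₁ (stable γ) ≤ ξ × H ξ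
              sample γ = H-unbounded (proj₁ (stable γ))
              z : Baire κ
              z γ = y (proj₁ (sample γ)) γ
              converges : ∀ γ → ∃[ η ] (∀ {ξ} → H ξ → η ≤ ξ → y ξ ≈[ γ ] z)
              converges γ with bounded {γ} (λ i → proj₁ (stable (value i)))
              ... | η , <η = η , λ Hξ η≤ξ {δ} δ<γ → proj₂ (stable δ) Hξ (proj₂ (proj₂ (sample δ)))
                (<⇒≤ (η≤ξ (<η (δ , [ δ<γ ])))) (proj₁ (proj₂ (sample δ)))
              z∈range : ∃[ x ] h x ≡ z
              z∈range = closed z λ γ →
                let η , y≈z = converges γ
                    ξ , η≤ξ , Hξ = H-unbounded η
                in p [ α ≔ ξ ] , y≈z Hξ η≤ξ
              x : Baire κ
              x = proj₁ z∈range
              -- Agreement is asked for beyond `α`, so that coordinate `α` itself is recovered.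
              inv : ∃[ γ ] (∀ {q} → h q ≈[ γ ] h x → q ≈[ proj₁ (noMax α) ] x)
              inv = inverse x (proj₁ (noMax α))
              η : K
              η = proj₁ (converges (proj₁ inv))
              fixed : ∀ {ξ} → H ξ → η ≤ ξ → ξ ≡ x α
              fixed {ξ} Hξ η≤ξ = trans (sym (updated p α)) (proj₂ inv
                (subst (y ξ ≈[ proj₁ inv ]_) (sym (proj₂ z∈range))
                  (proj₂ (converges (proj₁ inv)) Hξ η≤ξ))
                (proj₂ (noMax α)))
              ξ₁ ξ₂ : K
              ξ₁ = proj₁ (H-unbounded η)
              η≤ξ₁ : η ≤ ξ₁
              η≤ξ₁ = proj₁ (proj₂ (H-unbounded η))
              Hξ₁ : H ξ₁
              Hξ₁ = proj₂ (proj₂ (H-unbounded η))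
              ξ₂ = proj₁ (H-unbounded (proj₁ (noMax ξ₁)))
              ξ₁<ξ₂ : ξ₁ < ξ₂
              ξ₁<ξ₂ = proj₁ (proj₂ (H-unbounded (proj₁ (noMax ξ₁)))) (proj₂ (noMax ξ₁))
              Hξ₂ : H ξ₂
              Hξ₂ = proj₂ (proj₂ (H-unbounded (proj₁ (noMax ξ₁))))

        divergent : ¬ ¬ Splits
        divergent ¬splits with proj₂ weaklyCompact colour
        ... | H , H↔K , b , homogeneous = ¬stable ¬splits H (↔⇒Unbounded H↔K)
          (<-induction _ λ γ → stable-step ¬splits H (↔⇒Unbounded H↔K) b homogeneous γ)

    -- From the Hurewicz dichotomy to measurability.

    HasSubtree : ∀ {x} → Set x → Pred (Seq κ) ℓ → Pred (Baire κ) ℓ → Set (lsuc ℓ ⊔ x)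
    HasSubtree X T A = Σ[ S ∈ Pred (Seq κ) ℓ ]
      (Satisfiable S × Subtree κ S × Superclosed κ S × Splitting κ X S) × S ⊆ T ×
      (Branches κ S ⊆ A ⊎ Branches κ S ⊥ A)

    scheme⇒HasSubtree : ∀ {x} {X : Set x} {G T A} → Scheme X G → X → (∀ u → G u ∈ Branches κ T) →
                        (∀ u → G u ∈ A) ⊎ (∀ u → ¬ G u ∈ A) → HasSubtree X T A
    scheme⇒HasSubtree {G = G} {T} {A} scheme a G∈T side with Scheme⇒Tree noMax inhabited scheme a
    ... | S , S-tree , S-node , S-branch = S , S-tree ,
      (λ {s} s∈S → let u , s≡ = S-node s∈S in subst T (sym s≡) (G∈T u (length s))) , decide side
      where
      decide : (∀ u → G u ∈ A) ⊎ (∀ u → ¬ G u ∈ A) → Branches κ S ⊆ A ⊎ Branches κ S ⊥ A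
      decide (inj₁ G∈A) = inj₁ λ x∈S → let u , x≡ = S-branch x∈S in subst A (sym x≡) (G∈A u)
      decide (inj₂ G∉A) = inj₂ λ (x∈S , x∈A) → let u , x≡ = S-branch x∈S in G∉A u (subst A x≡ x∈A)

    -- The two alternatives trade places under complements; this is how `Π¹₁` sets reduce to `Σ¹₁`
    -- sets.
    Measurable-∁ : ∀ {P A} → Measurable κ P (∁ A) → Measurable κ P A
    Measurable-∁ meas T PT with meas T PT
    ... | S , PS , S⊆T , inj₁ S⊆∁A =
      S , PS , S⊆T , inj₂ λ (x∈S , x∈A) → S⊆∁A x∈S x∈A
    ... | S , PS , S⊆T , inj₂ S⊥∁A =
      S , PS , S⊆T , inj₁ λ x∈S → byContradiction λ x∉A → S⊥∁A (x∈S , x∉A)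

    module _ (hurewicz : ∀ A → Σ¹₁ κ A → HurewiczDichotomy κ A) where

      sacks : ∀ A → Σ¹₁ κ A → SacksMeasurable κ A
      sacks A A-Σ T T-perfect with treeScheme 0≢1 T-perfect
      ... | G , 𝔾 , G∈T = split (hurewicz (F ⊢ A) (Σ¹₁-preimage F-modulus A-Σ))
        where
        F : Baire κ → Baire κ
        F = G ∘ initialSegments
        F-modulus : Modulus F
        F-modulus = Modulus-∘ (Scheme⇒Modulus 𝔾) initialSegments-modulus
        F-injective : ∀ {x y} → F x ≡ F y → x ≡ y
        F-injective = initialSegments-injective ∘ Scheme.injective 𝔾
        -- Both cases of the dichotomy supply such an `h`. Injectivity of `F ∘ h` suffices, since
        -- binary splitting needs only two points with different images.
        perfect : ∀ {h} → Modulus h → (∀ {x y} → h x ≡ h y → x ≡ y) →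
                  (∀ x → F (h x) ∈ A) ⊎ (∀ x → ¬ F (h x) ∈ A) → HasSubtree (Fin 2) T A
        perfect {h} h-mod h-inj side
          with mapScheme 0≢1 (Modulus-∘ F-modulus h-mod)
                 (injective⇒LocallySplitting (h-inj ∘ F-injective))
        ... | H , scheme = scheme⇒HasSubtree scheme zero (λ u → G∈T _) (Sum.map (_∘ H) (_∘ H) side)
        split : HurewiczDichotomy κ (F ⊢ A) → HasSubtree (Fin 2) T A
        split (inj₁ (B , B-K , FA⊆B)) =
          let g , undominating = K-κ⇒undominating B-K
              M , 𝕄 , g≤M = dominator g
          in perfect (Scheme⇒Modulus 𝕄) (Scheme.injective 𝕄)
               (inj₂ λ x Fx∈A → undominating (g≤M x) (FA⊆B Fx∈A))
        split (inj₂ (C , C⊆FA , C-closed , C≅)) =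
          let h , embedding = homeomorphic⇒ClosedEmbedding C-closed C≅
              open ClosedEmbedding embedding
          in perfect modulus injective (inj₁ λ x → C⊆FA (range x))

      miller : WeaklyCompact κ → ∀ A → Σ¹₁ κ A → MillerMeasurable κ A
      miller weaklyCompact A A-Σ T T-miller with treeScheme distinct-≢ T-miller
      ... | G , 𝔾 , G∈T = split (hurewicz (G ⊢ A) (Σ¹₁-preimage (Scheme⇒Modulus 𝔾) A-Σ))
        where
        split : HurewiczDichotomy κ (G ⊢ A) → HasSubtree K T A
        split (inj₁ (B , B-K , GA⊆B)) =
          let g , undominating = K-κ⇒undominating B-K
              M , 𝕄 , g≤M = dominator g
          in scheme⇒HasSubtree (Scheme-∘ 𝔾 𝕄) inhabited (λ u → G∈T (M u))
               (inj₂ λ u Gu∈A → undominating (g≤M u) (GA⊆B Gu∈A))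
        split (inj₂ (C , C⊆GA , C-closed , C≅)) =
          let h , embedding = homeomorphic⇒ClosedEmbedding C-closed C≅
              open ClosedEmbedding embedding
              H , ℍ = mapScheme distinct-≢ modulus
                (embedding⇒LocallySplitting weaklyCompact embedding distinct-≢)
          in scheme⇒HasSubtree (Scheme-∘ 𝔾 ℍ) inhabited (λ u → G∈T (h (H u)))
               (inj₁ λ u → C⊆GA (range (H u)))

theorem5p2 : (∀ {a} → ExcludedMiddle a) →
    (∀ {a b} → Extensionality a b) →
    ∀ {ℓ} (κ : Cardinal ℓ) → Uncountable κ → κ^<κ≡κ κ →
    (∀ A → Σ¹₁ κ A → HurewiczDichotomy κ A) →
    (¬ WeaklyCompact κ →
    (∀ A → Σ¹₁ κ A → SacksMeasurable κ A) × (∀ A → Π¹₁ κ A → SacksMeasurable κ A))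
    × (WeaklyCompact κ →
    (∀ A → Σ¹₁ κ A → MillerMeasurable κ A) × (∀ A → Π¹₁ κ A → MillerMeasurable κ A))
theorem5p2 em ext κ uncountable code hurewicz =
  (λ _ → sacks hurewicz , λ A A-Π → Measurable-∁ {Perfect κ} (sacks hurewicz (∁ A) A-Π)) ,
  λ wc → miller hurewicz wc , λ A A-Π → Measurable-∁ {Miller κ} (miller hurewicz wc (∁ A) A-Π)
  where open Regular em ext κ uncountable code
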